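{- There exist absolute constants $c,C>0$ such that the following holds. Let $n$ be odd and let $k$ be an even integer with $2\lfloor n/5\rfloor<k\le 2\lfloor n/4\rfloor$. Then every $k$-regular graph on $n$ vertices contains at least $cn^2$ triangles; and there exists a $k$-regular graph on $n$ vertices containing at most $Cn^2$ triangles.
   Context: Graphs are finite and simple; a triangle is a copy of $K_3$. -}

module Defs where

open import Data.Nat using (ℕ; _<_; _^_)
open import Data.Bool using (Bool; true; false; _∧_)
open import Data.Fin using (Fin; toℕ)
open import Data.List using (List; length; filter; allFin; concatMap; map)
open import Data.Product using (_×_; _,_)
open import Relation.Binary.PropositionalEquality using (_≡_)
open import Relation.Nullary.Decidable using (Dec; ⌊_⌋)
open import Data.Nat using (_<?_)
open import Data.Integer using (+_)
open import Data.Rational using (ℚ; _/_)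

record Graph (n : ℕ) : Set where
  field
    adj   : Fin n → Fin n → Bool
    sym   : ∀ i j → adj i j ≡ adj j i
    irrefl : ∀ i → adj i i ≡ false
open Graph public

degree : ∀ {n} → Graph n → Fin n → ℕ
degree G i = length (filter (λ j → adj G i j ≡? true) (allFin _))
  where
  open import Data.Bool.Properties using () renaming (_≟_ to _≡?_)

Regular : ∀ {n} → ℕ → Graph n → Set
Regular k G = ∀ i → degree G i ≡ k

triples : (n : ℕ) → List (Fin n × Fin n × Fin n)
triples n = concatMap (λ i → concatMap (λ j → map (λ l → (i , j , l)) (allFin n)) (allFin n)) (allFin n)

isTriangle : ∀ {n} → Graph n → Fin n × Fin n × Fin n → Bool
isTriangle G (i , j , l) =
  ⌊ toℕ i <? toℕ j ⌋ ∧ ⌊ toℕ j <? toℕ l ⌋ ∧ adj G i j ∧ adj G j l ∧ adj G i l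

-- number of triangles of G (each counted once, as its unique increasing triple)
triangles : ∀ {n} → Graph n → ℕ
triangles {n} G = length (filter (λ t → isTriangle G t ≟ true) (triples n))
  where
  open import Data.Bool.Properties using (_≟_)

ℕ→ℚ : ℕ → ℚ
ℕ→ℚ m = (+ m) / 1

{-# OPTIONS --safe #-}

-- Upper bound. Write n = 2m+1 and k = 2j. In a k-regular bipartite graph with parts of size m, delete
-- j edges of a matching and join all their endpoints to one new vertex. All triangles contain that
-- vertex, so there are at most n² of them.
--
-- Lower bound. Suppose there are fewer than cn² triangles. Call an edge free if it lies in no triangle,
-- and a vertex good if few of its edges are not free; few vertices are bad. As 5k > 2n, some vertex
-- sees three, hence two consecutive, vertices of any closed 5-walk, so the free edges contain no closed
-- 5-walk. Fix a good vertex v. The vertices sharing a free neighbour with v span no free edge, and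
-- neither do the other good vertices: a free edge xy among them would make the free neighbourhoods of
-- v, x and y disjoint, each with more than n/3 vertices. Put every bad vertex on the side where it has
-- fewer good neighbours. As n is odd, one side A is larger, so |B| < n/2 and regularity yields at least
-- k/2 edges inside A. An edge of A with a good endpoint lies in at least n/20 triangles; hence every
-- vertex of A has few neighbours in A, so every edge of A lies in at least n/20 triangles, and there
-- are too many triangles after all.
module Submission where

open import Defs
open import Data.Nat using (ℕ; _+_; _*_; _^_; _/_; _<_; _≤_)
open import Data.Product using (Σ; ∃; _×_; _,_)
open import Relation.Binary.PropositionalEquality using (_≡_)
open import Data.Rational using (ℚ; 0ℚ) renaming (_<_ to _<ℚ_; _≤_ to _≤ℚ_; _*_ to _*ℚ_)

open import Data.Bool using (Bool; true; false; _∧_; not; if_then_else_)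
open import Data.Bool.Properties using (_≟_; ∧-comm; ∧-zeroʳ; T-≡)
open import Data.Empty using (⊥; ⊥-elim)
open import Data.Fin using (Fin; zero; suc; toℕ)
open import Data.Fin.Properties using (toℕ-injective; toℕ<n)
import Data.Integer as ℤ
import Data.Integer.Properties as ℤ
open import Data.List using (List; length; filter; tabulate; concatMap; map; allFin)
open import Data.List.Properties using (filter-++; length-++; map-tabulate)
open import Data.Nat using (zero; suc; _%_; _∸_; z≤n; s≤s; _<ᵇ_; _≡ᵇ_; _<?_; NonZero)
open import Data.Nat.DivMod using ([m+n]%n≡m%n; m<n⇒m%n≡m; m≡m%n+[m/n]*n; m%n<n; m/n*n≤m)
open import Data.Nat.Properties hiding (_≟_)
open import Algebra.Properties.Semiring.Sum +-*-semiring using (sum; sum-cong-≗; ∑-distrib-+; ∑-comm; *-distribˡ-sum; *-distribʳ-sum)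
open import Data.Nat.Tactic.RingSolver using (solve-∀)
open import Data.Product using (proj₁; proj₂)
open import Data.Rational using (1ℚ; toℚᵘ) renaming (_/_ to _/ℚ_)
import Data.Rational.Properties as ℚ
import Data.Rational.Unnormalised as ℚᵘ
import Data.Rational.Unnormalised.Properties as ℚᵘ
open import Function using (_∘_)
open import Function.Bundles using (Equivalence)
open import Relation.Binary.Definitions using (Tri; tri<; tri≈; tri>)
open import Relation.Binary.PropositionalEquality using (refl; trans; cong; cong₂; subst; module ≡-Reasoning) renaming (sym to ≡-sym)
open import Relation.Nullary using (yes; no; ¬_)

-- Finite sums and counting

⟦_⟧ : Bool → ℕ
⟦ true  ⟧ = 1
⟦ false ⟧ = 0

# : ∀ {n} → (Fin n → Bool) → ℕ
# P = sum (λ i → ⟦ P i ⟧)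

sum-mono-≤ : ∀ {n} {f g : Fin n → ℕ} → (∀ i → f i ≤ g i) → sum f ≤ sum g
sum-mono-≤ {zero}  f≤g = z≤n
sum-mono-≤ {suc n} f≤g = +-mono-≤ (f≤g zero) (sum-mono-≤ (f≤g ∘ suc))

sum-const : ∀ n c → sum {n} (λ _ → c) ≡ n * c
sum-const zero    c = refl
sum-const (suc n) c = cong (c +_) (sum-const n c)

f≤sum : ∀ {n} (f : Fin n → ℕ) i → f i ≤ sum f
f≤sum f zero    = m≤m+n _ _
f≤sum f (suc i) = ≤-trans (f≤sum (f ∘ suc) i) (m≤n+m _ _)

#-witness : ∀ {n} (P : Fin n → Bool) → 0 < # P → ∃ λ i → P i ≡ true
#-witness {suc n} P 0<#P with P zero in eq
... | true  = zero , eq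
... | false with i , Pi ← #-witness (P ∘ suc) 0<#P = suc i , Pi

length-filter-tabulate : ∀ {A : Set} {n} (P : A → Bool) (f : Fin n → A) →
  length (filter (λ x → P x ≟ true) (tabulate f)) ≡ # (P ∘ f)
length-filter-tabulate {n = zero}  P f = refl
length-filter-tabulate {n = suc n} P f with P (f zero)
... | true  = cong suc (length-filter-tabulate P (f ∘ suc))
... | false = length-filter-tabulate P (f ∘ suc)

length-filter-concatMap : ∀ {A B : Set} {n} (P : B → Bool) (g : A → List B) (f : Fin n → A) →
  length (filter (λ x → P x ≟ true) (concatMap g (tabulate f)))
    ≡ sum (λ i → length (filter (λ x → P x ≟ true) (g (f i))))
length-filter-concatMap {n = zero}  P g f = refl
length-filter-concatMap {n = suc n} P g f = trans
  (cong length (filter-++ (λ x → P x ≟ true) (g (f zero)) _))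
  (trans (length-++ (filter (λ x → P x ≟ true) (g (f zero))))
    (cong (length (filter (λ x → P x ≟ true) (g (f zero))) +_) (length-filter-concatMap P g (f ∘ suc))))

degree≡# : ∀ {n} (G : Graph n) i → degree G i ≡ # (adj G i)
degree≡# G i = length-filter-tabulate (adj G i) (λ j → j)

triangles≡sum : ∀ {n} (G : Graph n) →
  triangles G ≡ sum (λ i → sum (λ j → # (λ l → isTriangle G (i , j , l))))
triangles≡sum {n} G = trans (length-filter-concatMap P (λ i → concatMap (λ j → map (λ l → (i , j , l)) (allFin n)) (allFin n)) (λ i → i))
  (sum-cong-≗ λ i → trans (length-filter-concatMap P (λ j → map (λ l → (i , j , l)) (allFin n)) (λ j → j))
    (sum-cong-≗ λ j → trans
      (cong (length ∘ filter (λ x → P x ≟ true)) (map-tabulate (λ l → l) (λ l → (i , j , l))))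
      (length-filter-tabulate P (λ l → (i , j , l)))))
  where
  P : Fin n × Fin n × Fin n → Bool
  P = isTriangle G

-- Counting triangles through edges and common neighbours

module _ {n} (G : Graph n) where

  common : Fin n → Fin n → ℕ
  common x y = # (λ z → adj G x z ∧ adj G y z)

  -- Each triangle is counted once for every ordering of its vertices.
  orderedTriangles : ℕ
  orderedTriangles = sum (λ x → sum (λ y → ⟦ adj G x y ⟧ * common x y))

  private
    g inc : Fin n → Fin n → Fin n → ℕ
    g x y z   = ⟦ adj G x y ⟧ * ⟦ adj G x z ∧ adj G y z ⟧
    inc x y z = ⟦ isTriangle G (x , y , z) ⟧

    ∑³ : (Fin n → Fin n → Fin n → ℕ) → ℕ
    ∑³ f = sum (λ x → sum (λ y → sum (λ z → f x y z)))

    ∑³-+ : ∀ f h → ∑³ (λ x y z → f x y z + h x y z) ≡ ∑³ f + ∑³ h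
    ∑³-+ f h = trans
      (sum-cong-≗ λ x → trans (sum-cong-≗ λ y → ∑-distrib-+ (f x y) (h x y)) (∑-distrib-+ {n} _ _))
      (∑-distrib-+ {n} _ _)

    ∑³-swap₁₂ : ∀ f → ∑³ (λ x y z → f y x z) ≡ ∑³ f
    ∑³-swap₁₂ f = ∑-comm (λ x y → sum (f y x))

    ∑³-swap₂₃ : ∀ f → ∑³ (λ x y z → f x z y) ≡ ∑³ f
    ∑³-swap₂₃ f = sum-cong-≗ λ x → ∑-comm (λ y z → f x z y)

    inc-<< : ∀ {x y z} → toℕ x < toℕ y → toℕ y < toℕ z →
             ⟦ adj G x y ⟧ * ⟦ adj G x z ∧ adj G y z ⟧ ≤ inc x y z
    inc-<< {x} {y} {z} x<y y<z with toℕ x <? toℕ y | toℕ y <? toℕ z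
    ... | no x≮y | _      = ⊥-elim (x≮y x<y)
    ... | yes _  | no y≮z = ⊥-elim (y≮z y<z)
    ... | yes _  | yes _  with adj G x y | adj G x z | adj G y z
    ... | true  | true  | true  = ≤-refl
    ... | true  | true  | false = z≤n
    ... | true  | false | _     = z≤n
    ... | false | _     | _     = z≤n

    g-swap₁₂ : ∀ x y z → g x y z ≡ g y x z
    g-swap₁₂ x y z = cong₂ _*_ (cong ⟦_⟧ (sym G x y)) (cong ⟦_⟧ (∧-comm (adj G x z) (adj G y z)))

    g-swap₂₃ : ∀ x y z → g x y z ≡ g x z y
    g-swap₂₃ x y z rewrite sym G z y with adj G x y | adj G x z
    ... | true  | true  = refl
    ... | true  | false = refl
    ... | false | true  = refl
    ... | false | false = refl

    g-diag : ∀ x z → g x x z ≡ 0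
    g-diag x z rewrite irrefl G x = refl

    six : Fin n → Fin n → Fin n → ℕ
    six x y z = inc x y z + inc y x z + (inc x z y + inc z x y) + (inc y z x + inc z y x)

    -- Sort the three indices. If two of them coincide, `g` vanishes, as there are no loops.
    -- Otherwise exactly one ordering is increasing, and the symmetry of `g` carries the triple to
    -- it.
    g≤six : ∀ x y z → g x y z ≤ six x y z
    g≤six x y z with <-cmp (toℕ x) (toℕ y)
    ... | tri≈ _ x≡y _ rewrite toℕ-injective x≡y = ≤-trans (≤-reflexive (g-diag y z)) z≤n
    ... | tri< x<y _ _ with <-cmp (toℕ y) (toℕ z)
    ...   | tri< y<z _ _ = ≤-trans (inc-<< x<y y<z) (≤-trans (m≤m+n _ _) (≤-trans (m≤m+n _ _) (m≤m+n _ _)))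
    ...   | tri≈ _ y≡z _ rewrite toℕ-injective y≡z =
            ≤-trans (≤-reflexive (trans (g-swap₁₂ x z z) (trans (g-swap₂₃ z x z) (g-diag z x)))) z≤n
    ...   | tri> _ _ z<y with <-cmp (toℕ x) (toℕ z)
    ...     | tri< x<z _ _ = ≤-trans (≤-reflexive (g-swap₂₃ x y z)) (≤-trans (inc-<< x<z z<y)
                (≤-trans (≤-trans (m≤m+n _ _) (m≤n+m _ (inc x y z + inc y x z))) (m≤m+n _ _)))
    ...     | tri≈ _ x≡z _ rewrite toℕ-injective x≡z = ≤-trans (≤-reflexive (trans (g-swap₂₃ z y z) (g-diag z y))) z≤n
    ...     | tri> _ _ z<x = ≤-trans (≤-reflexive (trans (g-swap₂₃ x y z) (g-swap₁₂ x z y))) (≤-trans (inc-<< z<x x<y)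
                (≤-trans (≤-trans (m≤n+m _ (inc x z y)) (m≤n+m _ (inc x y z + inc y x z))) (m≤m+n _ _)))
    g≤six x y z | tri> _ _ y<x with <-cmp (toℕ x) (toℕ z)
    ...   | tri< x<z _ _ = ≤-trans (≤-reflexive (g-swap₁₂ x y z)) (≤-trans (inc-<< y<x x<z)
                (≤-trans (m≤n+m _ (inc x y z)) (≤-trans (m≤m+n _ _) (m≤m+n _ _))))
    ...   | tri≈ _ x≡z _ rewrite toℕ-injective x≡z = ≤-trans (≤-reflexive (trans (g-swap₂₃ z y z) (g-diag z y))) z≤n
    ...   | tri> _ _ z<x with <-cmp (toℕ y) (toℕ z)
    ...     | tri< y<z _ _ = ≤-trans (≤-reflexive (trans (g-swap₁₂ x y z) (g-swap₂₃ y x z))) (≤-trans (inc-<< y<z z<x)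
                (≤-trans (m≤m+n _ _) (m≤n+m _ (inc x y z + inc y x z + (inc x z y + inc z x y)))))
    ...     | tri≈ _ y≡z _ rewrite toℕ-injective y≡z =
            ≤-trans (≤-reflexive (trans (g-swap₁₂ x z z) (trans (g-swap₂₃ z x z) (g-diag z x)))) z≤n
    ...     | tri> _ _ z<y = ≤-trans (≤-reflexive (trans (g-swap₁₂ x y z) (trans (g-swap₂₃ y x z) (g-swap₁₂ y z x))))
                (≤-trans (inc-<< z<y y<x) (≤-trans (m≤n+m _ (inc y z x)) (m≤n+m _ (inc x y z + inc y x z + (inc x z y + inc z x y)))))

  orderedTriangles≤6*triangles : orderedTriangles ≤ 6 * triangles G
  orderedTriangles≤6*triangles = begin
    orderedTriangles
      ≡⟨ sum-cong-≗ (λ x → sum-cong-≗ λ y → *-distribˡ-sum ⟦ adj G x y ⟧ (λ z → ⟦ adj G x z ∧ adj G y z ⟧)) ⟩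
    ∑³ g
      ≤⟨ sum-mono-≤ (λ x → sum-mono-≤ λ y → sum-mono-≤ λ z → g≤six x y z) ⟩
    ∑³ six
      ≡⟨ trans (∑³-+ _ _) (cong₂ _+_ (trans (∑³-+ _ _) (cong₂ _+_ (∑³-+ _ _) (∑³-+ _ _))) (∑³-+ _ _)) ⟩
    ∑³ inc + ∑³ (λ x y z → inc y x z) + (∑³ (λ x y z → inc x z y) + ∑³ (λ x y z → inc z x y))
      + (∑³ (λ x y z → inc y z x) + ∑³ (λ x y z → inc z y x))
      ≡⟨ cong₂ _+_ (cong₂ _+_ (cong₂ _+_ e₁ e₂) (cong₂ _+_ e₃ e₄)) (cong₂ _+_ e₅ e₆) ⟩
    t + t + (t + t) + (t + t)
      ≡⟨ six≡ t ⟩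
    6 * t ∎
    where
    open ≤-Reasoning
    t = triangles G
    e₁ : ∑³ inc ≡ t
    e₁ = ≡-sym (triangles≡sum G)
    e₂ : ∑³ (λ x y z → inc y x z) ≡ t
    e₂ = trans (∑³-swap₁₂ inc) e₁
    e₃ : ∑³ (λ x y z → inc x z y) ≡ t
    e₃ = trans (∑³-swap₂₃ inc) e₁
    e₄ : ∑³ (λ x y z → inc z x y) ≡ t
    e₄ = trans (∑³-swap₂₃ (λ x y z → inc y x z)) e₂
    e₅ : ∑³ (λ x y z → inc y z x) ≡ t
    e₅ = trans (∑³-swap₁₂ (λ x y z → inc x z y)) e₃
    e₆ : ∑³ (λ x y z → inc z y x) ≡ t
    e₆ = trans (∑³-swap₁₂ (λ x y z → inc z x y)) e₄
    six≡ : ∀ m → m + m + (m + m) + (m + m) ≡ 6 * m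
    six≡ = solve-∀

-- Linear arithmetic and Boolean predicates

-- Certificate for linear arithmetic: `l ≤ r` is a sum of multiples of known inequalities, `s` is
-- the slack, and the remaining identity is left to the ring solver.
≤-certificate : ∀ {l r L R} s → l ≤ r → L + r + s ≡ R + l → L ≤ R
≤-certificate {l} {r} {L} {R} s l≤r eq = +-cancelʳ-≤ r L R (begin
  L + r     ≤⟨ m≤m+n _ s ⟩
  L + r + s ≡⟨ eq ⟩
  R + l     ≤⟨ +-monoʳ-≤ R l≤r ⟩
  R + r     ∎)
  where open ≤-Reasoning

∧-true⁻ : ∀ {a b} → a ∧ b ≡ true → a ≡ true × b ≡ true
∧-true⁻ {true} {true} _ = refl , refl

∧-true⁺ : ∀ {a b} → a ≡ true → b ≡ true → a ∧ b ≡ true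
∧-true⁺ refl refl = refl

⟦⟧-mono : ∀ {a b} → (a ≡ true → b ≡ true) → ⟦ a ⟧ ≤ ⟦ b ⟧
⟦⟧-mono {false} a⇒b = z≤n
⟦⟧-mono {true}  a⇒b rewrite a⇒b refl = ≤-refl

#-mono : ∀ {n} {P Q : Fin n → Bool} → (∀ i → P i ≡ true → Q i ≡ true) → # P ≤ # Q
#-mono P⇒Q = sum-mono-≤ λ i → ⟦⟧-mono (P⇒Q i)

#-split : ∀ {n} {P Q R : Fin n → Bool} → (∀ i → ⟦ Q i ⟧ + ⟦ R i ⟧ ≡ 1) →
          # (λ i → P i ∧ Q i) + # (λ i → P i ∧ R i) ≡ # P
#-split {n} {P} {Q} {R} Q⊎R = trans (≡-sym (∑-distrib-+ (λ i → ⟦ P i ∧ Q i ⟧) (λ i → ⟦ P i ∧ R i ⟧)))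
  (sum-cong-≗ λ i → pointwise (P i) (Q⊎R i))
  where
  pointwise : ∀ p {q r} → ⟦ q ⟧ + ⟦ r ⟧ ≡ 1 → ⟦ p ∧ q ⟧ + ⟦ p ∧ r ⟧ ≡ ⟦ p ⟧
  pointwise true  eq = eq
  pointwise false eq = refl

⟦b⟧+⟦not-b⟧ : ∀ b → ⟦ b ⟧ + ⟦ not b ⟧ ≡ 1
⟦b⟧+⟦not-b⟧ true  = refl
⟦b⟧+⟦not-b⟧ false = refl

#-complement : ∀ {n} {Q R : Fin n → Bool} → (∀ i → ⟦ Q i ⟧ + ⟦ R i ⟧ ≡ 1) → # Q + # R ≡ n
#-complement {n} Q⊎R = trans (#-split {P = λ _ → true} Q⊎R) (trans (sum-const n 1) (*-identityʳ n))

by-cases : ∀ {P : Set} b → (b ≡ true → P) → (b ≡ false → P) → P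
by-cases true  t f = t refl
by-cases false t f = f refl

∧-if-then : ∀ (f : Bool → Bool) g {a b} → g ∧ f (if g then a else b) ≡ g ∧ f a
∧-if-then f true  = refl
∧-if-then f false = refl

*⟦⟧-≤ : ∀ n b {m} → (b ≡ true → n ≤ m) → n * ⟦ b ⟧ ≤ m
*⟦⟧-≤ n true  n≤m = ≤-trans (≤-reflexive (*-identityʳ n)) (n≤m refl)
*⟦⟧-≤ n false n≤m = ≤-trans (≤-reflexive (*-zeroʳ n)) z≤n

not-true⁻ : ∀ {b} → not b ≡ true → b ≡ false
not-true⁻ {false} _ = refl

<ᵇ-true⁻ : ∀ {m n} → (m <ᵇ n) ≡ true → m < n
<ᵇ-true⁻ {m} {n} eq = <ᵇ⇒< m n (Equivalence.from T-≡ eq)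

<ᵇ-false⁻ : ∀ {m n} → (m <ᵇ n) ≡ false → n ≤ m
<ᵇ-false⁻ {m} {n} eq = ≮⇒≥ λ m<n → false≢true (trans (≡-sym eq) (Equivalence.to T-≡ (<⇒<ᵇ m<n)))
  where
  false≢true : ¬ false ≡ true
  false≢true ()

-- Multiply by `c` and cancel one factor `n`. This is how the scarcity of triangles is used: `t`
-- counts ordered triangles, and each of `m` objects accounts for at least n/d of them.
quadratic-cancel : ∀ c d {e} n m t → c * d ≡ e → n * m ≤ d * t → e * t < n * n → c * m < n
quadratic-cancel c d n m t refl nm≤dt small = *-cancelˡ-< n (c * m) n (begin-strict
  n * (c * m) ≡⟨ comm n c m ⟩
  c * (n * m) ≤⟨ *-monoʳ-≤ c nm≤dt ⟩
  c * (d * t) ≡⟨ *-assoc c d t ⟨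
  c * d * t   <⟨ small ⟩
  n * n       ∎)
  where
  open ≤-Reasoning
  comm : ∀ n c m → n * (c * m) ≡ c * (n * m)
  comm = solve-∀

-- The independence number of the 5-cycle. It limits how many vertices of a closed walk of free
-- edges a single vertex can see.
at-most-two : ∀ a b c d e →
  (a ≡ true → b ≡ true → ⊥) → (b ≡ true → c ≡ true → ⊥) → (c ≡ true → d ≡ true → ⊥) →
  (d ≡ true → e ≡ true → ⊥) → (e ≡ true → a ≡ true → ⊥) →
  ⟦ a ⟧ + (⟦ b ⟧ + (⟦ c ⟧ + (⟦ d ⟧ + ⟦ e ⟧))) ≤ 2
at-most-two true  true  c d e ab bc cd de ea = ⊥-elim (ab refl refl)
at-most-two a true  true  d e ab bc cd de ea = ⊥-elim (bc refl refl)
at-most-two a b true  true  e ab bc cd de ea = ⊥-elim (cd refl refl)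
at-most-two a b c true  true  ab bc cd de ea = ⊥-elim (de refl refl)
at-most-two true  b c d true  ab bc cd de ea = ⊥-elim (ea refl refl)
at-most-two false false false false false _ _ _ _ _ = z≤n
at-most-two false false false false true  _ _ _ _ _ = s≤s z≤n
at-most-two false false false true  false _ _ _ _ _ = s≤s z≤n
at-most-two false false true  false false _ _ _ _ _ = s≤s z≤n
at-most-two false false true  false true  _ _ _ _ _ = ≤-refl
at-most-two false true  false false false _ _ _ _ _ = s≤s z≤n
at-most-two false true  false false true  _ _ _ _ _ = ≤-refl
at-most-two false true  false true  false _ _ _ _ _ = ≤-refl
at-most-two true  false false false false _ _ _ _ _ = s≤s z≤n
at-most-two true  false false true  false _ _ _ _ _ = ≤-refl
at-most-two true  false true  false false _ _ _ _ _ = ≤-refl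

at-most-one : ∀ a b c →
  (a ≡ true → b ≡ true → ⊥) → (b ≡ true → c ≡ true → ⊥) → (c ≡ true → a ≡ true → ⊥) →
  ⟦ a ⟧ + (⟦ b ⟧ + ⟦ c ⟧) ≤ 1
at-most-one true  true  c     ab bc ca = ⊥-elim (ab refl refl)
at-most-one a     true  true  ab bc ca = ⊥-elim (bc refl refl)
at-most-one true  b     true  ab bc ca = ⊥-elim (ca refl refl)
at-most-one true  false false ab bc ca = ≤-refl
at-most-one false true  false ab bc ca = ≤-refl
at-most-one false false true  ab bc ca = ≤-refl
at-most-one false false false ab bc ca = z≤n

-- Regular graphs of odd order have many triangles

module FewTriangles {n k : ℕ} (G : Graph n) (reg : ∀ x → # (adj G x) ≡ k)
  (2n<5k : 2 * n < 5 * k) (few : 2500 * orderedTriangles G < n * n) where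

  -- Free edges and good vertices

  free inTriangle : Fin n → Fin n → Bool
  free x y       = adj G x y ∧ (common G x y ≡ᵇ 0)
  inTriangle x y = adj G x y ∧ not (common G x y ≡ᵇ 0)

  h : Fin n → ℕ
  h x = # (inTriangle x)

  good : Fin n → Bool
  good x = 50 * h x <ᵇ n

  #bad : ℕ
  #bad = # (not ∘ good)

  -- The ordered triangles with first vertex `x`; summed over `x` this is `orderedTriangles` by
  -- definition.
  row : Fin n → ℕ
  row x = sum (λ y → ⟦ adj G x y ⟧ * common G x y)

  #free+h≡k : ∀ x → # (free x) + h x ≡ k
  #free+h≡k x = trans (#-split {P = adj G x} λ y → ⟦b⟧+⟦not-b⟧ (common G x y ≡ᵇ 0)) (reg x)

  free⇒adj : ∀ {x y} → free x y ≡ true → adj G x y ≡ true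
  free⇒adj xy = proj₁ (∧-true⁻ xy)

  free-disjoint : ∀ {x y} → free x y ≡ true → ∀ z → adj G x z ≡ true → adj G y z ≡ true → ⊥
  free-disjoint {x} {y} xy z xz yz = <-irrefl (≡-sym common≡0) (begin-strict
    0                               <⟨ ≤-reflexive (cong ⟦_⟧ (≡-sym (∧-true⁺ xz yz))) ⟩
    ⟦ adj G x z ∧ adj G y z ⟧       ≤⟨ f≤sum (λ z → ⟦ adj G x z ∧ adj G y z ⟧) z ⟩
    common G x y                    ∎)
    where
    open ≤-Reasoning
    common≡0 : common G x y ≡ 0
    common≡0 = ≡ᵇ⇒≡ _ _ (Equivalence.from T-≡ (proj₂ (∧-true⁻ {adj G x y} xy)))

  free-sym : ∀ {x y} → free x y ≡ true → free y x ≡ true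
  free-sym {x} {y} xy = trans (cong₂ (λ a c → a ∧ (c ≡ᵇ 0)) (sym G y x)
    (sum-cong-≗ λ z → cong ⟦_⟧ (∧-comm (adj G y z) (adj G x z)))) xy

  -- Some vertex sees three of five cyclically consecutive vertices, as 5k > 2n.
  no-free-closed-5-walk : ∀ {p₀ p₁ p₂ p₃ p₄} →
    free p₀ p₁ ≡ true → free p₁ p₂ ≡ true → free p₂ p₃ ≡ true → free p₃ p₄ ≡ true → free p₄ p₀ ≡ true → ⊥
  no-free-closed-5-walk {p₀} {p₁} {p₂} {p₃} {p₄} e₀ e₁ e₂ e₃ e₄ = <⇒≱ 2n<5k (begin
    5 * k                            ≡⟨ cong₂ _+_ (r p₀) (cong₂ _+_ (r p₁) (cong₂ _+_ (r p₂) (cong₂ _+_ (r p₃) (trans (+-identityʳ k) (r p₄))))) ⟩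
    # a₀ + (# a₁ + (# a₂ + (# a₃ + # a₄)))
      ≡⟨ cong (# a₀ +_) (cong (# a₁ +_) (cong (# a₂ +_) (∑-distrib-+ (⟦_⟧ ∘ a₃) (⟦_⟧ ∘ a₄)))) ⟨
    # a₀ + (# a₁ + (# a₂ + sum f₃))  ≡⟨ cong (# a₀ +_) (cong (# a₁ +_) (∑-distrib-+ (⟦_⟧ ∘ a₂) f₃)) ⟨
    # a₀ + (# a₁ + sum f₂)           ≡⟨ cong (# a₀ +_) (∑-distrib-+ (⟦_⟧ ∘ a₁) f₂) ⟨
    # a₀ + sum f₁                    ≡⟨ ∑-distrib-+ (⟦_⟧ ∘ a₀) f₁ ⟨
    sum (λ x → ⟦ a₀ x ⟧ + f₁ x)
      ≤⟨ sum-mono-≤ (λ x → at-most-two (a₀ x) (a₁ x) (a₂ x) (a₃ x) (a₄ x)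
           (free-disjoint e₀ x) (free-disjoint e₁ x) (free-disjoint e₂ x) (free-disjoint e₃ x) (free-disjoint e₄ x)) ⟩
    sum {n} (λ _ → 2)                ≡⟨ sum-const n 2 ⟩
    n * 2                            ≡⟨ *-comm n 2 ⟩
    2 * n                            ∎)
    where
    open ≤-Reasoning
    a₀ a₁ a₂ a₃ a₄ : Fin n → Bool
    a₀ = adj G p₀
    a₁ = adj G p₁
    a₂ = adj G p₂
    a₃ = adj G p₃
    a₄ = adj G p₄
    f₁ f₂ f₃ : Fin n → ℕ
    f₃ x = ⟦ a₃ x ⟧ + ⟦ a₄ x ⟧
    f₂ x = ⟦ a₂ x ⟧ + f₃ x
    f₁ x = ⟦ a₁ x ⟧ + f₂ x
    r : ∀ p → k ≡ # (adj G p)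
    r p = ≡-sym (reg p)

  h≤row : ∀ x → h x ≤ row x
  h≤row x = sum-mono-≤ λ y → pointwise (adj G x y) (common G x y)
    where
    pointwise : ∀ a c → ⟦ a ∧ not (c ≡ᵇ 0) ⟧ ≤ ⟦ a ⟧ * c
    pointwise false c       = z≤n
    pointwise true  zero    = z≤n
    pointwise true  (suc c) = s≤s z≤n

  -- A bad vertex has at least n/50 edges in triangles, hence is the first vertex of at least n/50
  -- ordered triangles.
  50#bad<n : 50 * #bad < n
  -- The constant 2500 is 50 · 50 here and 125 · 20 in the later uses.
  50#bad<n = quadratic-cancel 50 50 n #bad (orderedTriangles G) refl (begin
    n * #bad                              ≡⟨ *-distribˡ-sum n (⟦_⟧ ∘ not ∘ good) ⟩
    sum (λ x → n * ⟦ not (good x) ⟧)      ≤⟨ sum-mono-≤ pointwise ⟩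
    sum (λ x → 50 * row x)                ≡⟨ *-distribˡ-sum 50 row ⟨
    50 * orderedTriangles G               ∎) few
    where
    open ≤-Reasoning
    pointwise : ∀ x → n * ⟦ not (good x) ⟧ ≤ 50 * row x
    pointwise x = *⟦⟧-≤ n (not (good x)) λ bad → ≤-trans (<ᵇ-false⁻ (not-true⁻ bad)) (*-monoʳ-≤ 50 (h≤row x))

  good-vertex : ∃ λ v → good v ≡ true
  good-vertex = #-witness good (≰⇒> λ #good≤0 → <⇒≱ 50#bad<n (begin
    n              ≡⟨ #-complement (λ x → ⟦b⟧+⟦not-b⟧ (good x)) ⟨
    # good + #bad  ≤⟨ +-monoˡ-≤ #bad #good≤0 ⟩
    #bad           ≤⟨ m≤n*m #bad 50 ⟩
    50 * #bad      ∎))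
    where open ≤-Reasoning

  -- Triangles on the edges inside the larger side

  goodNbrs : (Fin n → Bool) → Fin n → ℕ
  goodNbrs S z = # (λ y → adj G z y ∧ (good y ∧ S y))

  -- The partition is abstract so that the argument serves whichever of the two sides turns out to
  -- be larger.
  module LargerSide (A B : Fin n → Bool) (A⊎B : ∀ z → ⟦ A z ⟧ + ⟦ B z ⟧ ≡ 1)
    (A-free-independent : ∀ {x y} → good x ≡ true → good y ≡ true → A x ≡ true → A y ≡ true → free x y ≡ true → ⊥)
    (A-majority : ∀ z → good z ≡ false → A z ≡ true → goodNbrs A z ≤ goodNbrs B z)
    (B<A : # B < # A) where

    dA dB : Fin n → ℕ
    dA z = # (λ y → adj G z y ∧ A y)
    dB z = # (λ y → adj G z y ∧ B y)

    dA+dB≡k : ∀ z → dA z + dB z ≡ k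
    dA+dB≡k z = trans (#-split {P = adj G z} A⊎B) (reg z)

    dA≤goodNbrs+#bad : ∀ z → dA z ≤ goodNbrs A z + #bad
    dA≤goodNbrs+#bad z = ≤-trans (sum-mono-≤ λ y → pointwise (adj G z y) (good y) (A y))
      (≤-reflexive (∑-distrib-+ (λ y → ⟦ adj G z y ∧ (good y ∧ A y) ⟧) (⟦_⟧ ∘ not ∘ good)))
      where
      pointwise : ∀ a g p → ⟦ a ∧ p ⟧ ≤ ⟦ a ∧ (g ∧ p) ⟧ + ⟦ not g ⟧
      pointwise true  true  p     = m≤m+n _ 0
      pointwise true  false true  = ≤-refl
      pointwise true  false false = z≤n
      pointwise false g     p     = z≤n

    goodNbrs≤dB : ∀ z → goodNbrs B z ≤ dB z
    goodNbrs≤dB z = #-mono λ y t → let a , g∧b = ∧-true⁻ {adj G z y} t in ∧-true⁺ a (proj₂ (∧-true⁻ {good y} g∧b))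

    goodNbrs≤h : ∀ x → good x ≡ true → A x ≡ true → goodNbrs A x ≤ h x
    goodNbrs≤h x gx Ax = #-mono λ y t →
      let a , t′ = ∧-true⁻ {adj G x y} t ; gy , Ay = ∧-true⁻ t′
      in ∧-true⁺ a (not-free {adj G x y} {common G x y ≡ᵇ 0} a (A-free-independent {x} {y} gx gy Ax Ay))
      where
      not-free : ∀ {a c} → a ≡ true → (a ∧ c ≡ true → ⊥) → not c ≡ true
      not-free {c = true}  refl ¬c = ⊥-elim (¬c refl)
      not-free {c = false} refl ¬c = refl

    -- Neighbours in `A` are good or bad, fewer than n/50 of either sort, so `dB z` exceeds k -
    -- n/25. The hypothesis is available first for good vertices of `A`, and after `50goodNbrs<n`
    -- for all of `A`.
    50k≤50dB+2n : ∀ z → 50 * goodNbrs A z < n → 50 * k ≤ 50 * dB z + 2 * n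
    50k≤50dB+2n z small = begin
      50 * k                                             ≡⟨ cong (50 *_) (dA+dB≡k z) ⟨
      50 * (dA z + dB z)                                 ≤⟨ *-monoʳ-≤ 50 (+-monoˡ-≤ (dB z) (dA≤goodNbrs+#bad z)) ⟩
      50 * (goodNbrs A z + #bad + dB z)                  ≡⟨ expand (goodNbrs A z) #bad (dB z) ⟩
      50 * dB z + (50 * goodNbrs A z + (50 * #bad + 0))  ≤⟨ +-monoʳ-≤ (50 * dB z) (+-mono-≤ (<⇒≤ small) (+-monoˡ-≤ 0 (<⇒≤ 50#bad<n))) ⟩
      50 * dB z + 2 * n                                  ∎
      where
      open ≤-Reasoning
      expand : ∀ g b d → 50 * (g + b + d) ≡ 50 * d + (50 * g + (50 * b + 0))
      expand = solve-∀

    50k≤50dB+2n-good : ∀ x → good x ≡ true → A x ≡ true → 50 * k ≤ 50 * dB x + 2 * n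
    50k≤50dB+2n-good x gx Ax = 50k≤50dB+2n x (≤-<-trans (*-monoʳ-≤ 50 (goodNbrs≤h x gx Ax)) (<ᵇ-true⁻ gx))

    -- For a bad vertex the majority rule gives `dA z ≤ dB z + #bad`, so about half of its
    -- neighbours lie in `B`.
    50k≤100dB+n : ∀ z → A z ≡ true → 50 * k ≤ 100 * dB z + n
    50k≤100dB+n z Az = by-cases (good z)
      -- Doubling the bound for good vertices loses 4n where only n is allowed, but gains 50k, which
      -- is at least 20n; this leaves 17n.
      (λ gz → ≤-certificate (17 * n)
        (+-mono-≤ (*-monoʳ-≤ 2 (50k≤50dB+2n-good z gz Az)) (*-monoʳ-≤ 10 (<⇒≤ 2n<5k)))
        (identity n k (dB z)))
      (λ bz → begin
        50 * k                              ≡⟨ cong (50 *_) (dA+dB≡k z) ⟨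
        50 * (dA z + dB z)                  ≤⟨ *-monoʳ-≤ 50 (+-monoˡ-≤ (dB z) (≤-trans (dA≤goodNbrs+#bad z)
                                                 (+-monoˡ-≤ #bad (≤-trans (A-majority z bz Az) (goodNbrs≤dB z))))) ⟩
        50 * (dB z + #bad + dB z)           ≡⟨ expand (dB z) #bad ⟩
        100 * dB z + 50 * #bad              ≤⟨ +-monoʳ-≤ (100 * dB z) (<⇒≤ 50#bad<n) ⟩
        100 * dB z + n                      ∎)
      where
      open ≤-Reasoning
      identity : ∀ n k d → 50 * k + (2 * (50 * d + 2 * n) + 10 * (5 * k)) + 17 * n
                             ≡ 100 * d + n + (2 * (50 * k) + 10 * (2 * n))
      identity = solve-∀
      expand : ∀ d b → 50 * (d + b + d) ≡ 100 * d + 50 * b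
      expand = solve-∀

    2#B≤n : 2 * # B ≤ n
    2#B≤n = begin
      # B + (# B + 0)  ≤⟨ +-mono-≤ (<⇒≤ B<A) (≤-reflexive (+-identityʳ _)) ⟩
      # A + # B        ≡⟨ #-complement A⊎B ⟩
      n                ∎
      where open ≤-Reasoning

    -- Inclusion and exclusion for the two neighbourhoods within `B`.
    dB+dB≤common+#B : ∀ z x → dB z + dB x ≤ common G z x + # B
    dB+dB≤common+#B z x = begin
      dB z + dB x
        ≡⟨ ∑-distrib-+ (λ y → ⟦ adj G z y ∧ B y ⟧) (λ y → ⟦ adj G x y ∧ B y ⟧) ⟨
      sum (λ y → ⟦ adj G z y ∧ B y ⟧ + ⟦ adj G x y ∧ B y ⟧)
        ≤⟨ sum-mono-≤ (λ y → pointwise (adj G z y) (adj G x y) (B y)) ⟩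
      sum (λ y → ⟦ adj G z y ∧ adj G x y ⟧ + ⟦ B y ⟧)
        ≡⟨ ∑-distrib-+ (λ y → ⟦ adj G z y ∧ adj G x y ⟧) (⟦_⟧ ∘ B) ⟩
      common G z x + # B ∎
      where
      open ≤-Reasoning
      pointwise : ∀ a b p → ⟦ a ∧ p ⟧ + ⟦ b ∧ p ⟧ ≤ ⟦ a ∧ b ⟧ + ⟦ p ⟧
      pointwise true  true  p     = ≤-trans (+-monoˡ-≤ ⟦ p ⟧ (⟦⟧-mono {p} {true} λ _ → refl)) ≤-refl
      pointwise true  false p     = ≤-reflexive (+-identityʳ ⟦ p ⟧)
      pointwise false true  p     = ≤-refl
      pointwise false false p     = z≤n

    -- Inside `B`, which has at most n/2 vertices, `z` has at least k/2 - n/100 neighbours and `x`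
    -- at least k - n/25. They share at least 3k/2 - 11n/20, and 3k/2 > 3n/5.
    n≤20common : ∀ z x → A z ≡ true → 50 * k ≤ 50 * dB x + 2 * n → n ≤ 20 * common G z x
    n≤20common z x Az dBx-large = *-cancelˡ-≤ 5 (≤-certificate 0
      (+-mono-≤ (*-monoʳ-≤ 2 dBx-large) (+-mono-≤ (50k≤100dB+n z Az) (+-mono-≤ (*-monoʳ-≤ 100 (dB+dB≤common+#B z x))
        (+-mono-≤ (*-monoʳ-≤ 50 2#B≤n) (*-monoʳ-≤ 30 (<⇒≤ 2n<5k))))))
      (identity n k (dB x) (dB z) (common G z x) (# B)))
      where
      identity : ∀ n k x z c b →
        5 * n + (2 * (50 * x + 2 * n) + (100 * z + n + (100 * (c + b) + (50 * n + 30 * (5 * k))))) + 0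
          ≡ 5 * (20 * c) + (2 * (50 * k) + (50 * k + (100 * (z + x) + (50 * (2 * b) + 30 * (2 * n)))))
      identity = solve-∀

    n*#≤20row : ∀ z (P : Fin n → Bool) →
      (∀ x → P x ≡ true → adj G z x ≡ true × n ≤ 20 * common G z x) → n * # P ≤ 20 * row z
    n*#≤20row z P many = begin
      n * # P                                               ≡⟨ *-distribˡ-sum n (⟦_⟧ ∘ P) ⟩
      sum (λ x → n * ⟦ P x ⟧)                               ≤⟨ sum-mono-≤ pointwise ⟩
      sum (λ x → 20 * (⟦ adj G z x ⟧ * common G z x))       ≡⟨ *-distribˡ-sum 20 (λ x → ⟦ adj G z x ⟧ * common G z x) ⟨
      20 * row z                                            ∎
      where
      open ≤-Reasoning
      pointwise : ∀ x → n * ⟦ P x ⟧ ≤ 20 * (⟦ adj G z x ⟧ * common G z x)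
      pointwise x = *⟦⟧-≤ n (P x) λ Px → let zx , n≤20c = many x Px in ≤-trans n≤20c
        (*-monoʳ-≤ 20 (≤-reflexive (≡-sym (trans (cong (λ a → ⟦ a ⟧ * common G z x) zx) (*-identityˡ (common G z x))))))

    -- Extends to bad vertices what is known for good ones: an edge from `z` to a good vertex of `A`
    -- lies in at least n/20 triangles, so there cannot be many such edges.
    50goodNbrs<n : ∀ z → A z ≡ true → 50 * goodNbrs A z < n
    -- The count gives the bound with 125 in place of 50, and 125 = 50 + 75.
    50goodNbrs<n z Az = ≤-<-trans (*-monoˡ-≤ (goodNbrs A z) (m≤m+n 50 75))
      (quadratic-cancel 125 20 n (goodNbrs A z) (orderedTriangles G) refl
        (≤-trans (n*#≤20row z _ λ x t → let a , t′ = ∧-true⁻ t ; gx , Ax = ∧-true⁻ t′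
                                        in a , n≤20common z x Az (50k≤50dB+2n-good x gx Ax))
          (*-monoʳ-≤ 20 (f≤sum row z))) few)

    -- Twice the number of edges inside `A`.
    eA : ℕ
    eA = sum (λ z → ⟦ A z ⟧ * dA z)

    -- The degrees in `A` sum to at least (|B| + 1)k, and at most |B|k of this goes to edges between
    -- `A` and `B`, as each vertex of `B` has degree `k`.
    k≤eA : k ≤ eA
    k≤eA = +-cancelʳ-≤ (# B * k) k eA (begin
      k + # B * k                                          ≤⟨ *-monoˡ-≤ k B<A ⟩
      # A * k                                              ≡⟨ *-distribʳ-sum k (⟦_⟧ ∘ A) ⟩
      sum (λ z → ⟦ A z ⟧ * k)
        ≡⟨ sum-cong-≗ (λ z → trans (cong (⟦ A z ⟧ *_) (≡-sym (dA+dB≡k z))) (*-distribˡ-+ ⟦ A z ⟧ (dA z) (dB z))) ⟩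
      sum (λ z → ⟦ A z ⟧ * dA z + ⟦ A z ⟧ * dB z)
        ≡⟨ ∑-distrib-+ (λ z → ⟦ A z ⟧ * dA z) (λ z → ⟦ A z ⟧ * dB z) ⟩
      eA + sum (λ z → ⟦ A z ⟧ * dB z)                      ≤⟨ +-monoʳ-≤ eA cross ⟩
      eA + # B * k                                         ∎)
      where
      open ≤-Reasoning
      pointwise : ∀ p q a → ⟦ p ⟧ * ⟦ a ∧ q ⟧ ≤ ⟦ q ⟧ * ⟦ a ⟧
      pointwise true  true  true  = ≤-refl
      pointwise true  true  false = z≤n
      pointwise true  false true  = z≤n
      pointwise true  false false = z≤n
      pointwise false q     a     = z≤n
      cross : sum (λ z → ⟦ A z ⟧ * dB z) ≤ # B * k
      cross = begin
        sum (λ z → ⟦ A z ⟧ * dB z)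
          ≡⟨ sum-cong-≗ (λ z → *-distribˡ-sum ⟦ A z ⟧ (λ y → ⟦ adj G z y ∧ B y ⟧)) ⟩
        sum (λ z → sum (λ y → ⟦ A z ⟧ * ⟦ adj G z y ∧ B y ⟧))
          ≡⟨ ∑-comm (λ z y → ⟦ A z ⟧ * ⟦ adj G z y ∧ B y ⟧) ⟩
        sum (λ y → sum (λ z → ⟦ A z ⟧ * ⟦ adj G z y ∧ B y ⟧))
          ≤⟨ sum-mono-≤ (λ y → sum-mono-≤ λ z → ≤-trans (pointwise (A z) (B y) (adj G z y))
               (≤-reflexive (cong (λ a → ⟦ B y ⟧ * ⟦ a ⟧) (sym G z y)))) ⟩
        sum (λ y → sum (λ z → ⟦ B y ⟧ * ⟦ adj G y z ⟧))
          ≡⟨ sum-cong-≗ (λ y → trans (≡-sym (*-distribˡ-sum ⟦ B y ⟧ (⟦_⟧ ∘ adj G y))) (cong (⟦ B y ⟧ *_) (reg y))) ⟩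
        sum (λ y → ⟦ B y ⟧ * k)
          ≡⟨ *-distribʳ-sum k (⟦_⟧ ∘ B) ⟨
        # B * k ∎

    n*eA≤20orderedTriangles : n * eA ≤ 20 * orderedTriangles G
    n*eA≤20orderedTriangles = begin
      n * eA                               ≡⟨ *-distribˡ-sum n (λ z → ⟦ A z ⟧ * dA z) ⟩
      sum (λ z → n * (⟦ A z ⟧ * dA z))     ≤⟨ sum-mono-≤ pointwise ⟩
      sum (λ z → 20 * row z)               ≡⟨ *-distribˡ-sum 20 row ⟨
      20 * orderedTriangles G              ∎
      where
      open ≤-Reasoning
      pointwise : ∀ z → n * (⟦ A z ⟧ * dA z) ≤ 20 * row z
      pointwise z = by-cases (A z)
        (λ Az → ≤-trans (≤-reflexive (cong (n *_) (trans (cong (λ a → ⟦ a ⟧ * dA z) Az) (*-identityˡ (dA z)))))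
          (n*#≤20row z _ λ x t → let a , Ax = ∧-true⁻ t
                                 in a , n≤20common z x Az (50k≤50dB+2n x (50goodNbrs<n x Ax))))
        (λ ¬Az → ≤-trans (≤-reflexive (trans (cong (λ a → n * (⟦ a ⟧ * dA z)) ¬Az) (*-zeroʳ n))) z≤n)

    -- At least `k` ordered edges inside `A`, each in at least n/20 triangles, force k < n/125,
    -- whereas k > 2n/5.
    absurd : ⊥
    absurd = <⇒≱ 125k<n (begin
      n          ≤⟨ m≤n*m n 50 ⟩
      50 * n     ≡⟨ *-assoc 25 2 n ⟩
      25 * (2 * n) ≤⟨ *-monoʳ-≤ 25 (<⇒≤ 2n<5k) ⟩
      25 * (5 * k) ≡⟨ *-assoc 25 5 k ⟨
      125 * k    ∎)
      where
      open ≤-Reasoning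
      125k<n : 125 * k < n
      125k<n = quadratic-cancel 125 20 n k (orderedTriangles G) refl
        (≤-trans (*-monoʳ-≤ n k≤eA) n*eA≤20orderedTriangles) few

  -- The partition around a good vertex

  v : Fin n
  v = proj₁ good-vertex

  Y X : Fin n → Bool
  Y w = 0 <ᵇ # (λ z → free v z ∧ free w z)
  X w = not (Y w)

  -- If `b` and `c` are free neighbours that `v` shares with `x` and `y`, a free edge xy closes the
  -- 5-walk v, b, x, y, c.
  Y-free-independent : ∀ {x y} → Y x ≡ true → Y y ≡ true → free x y ≡ true → ⊥
  Y-free-independent {x} {y} Yx Yy xy =
    let b , vb∧xb = #-witness (λ z → free v z ∧ free x z) (<ᵇ-true⁻ Yx)
        c , vc∧yc = #-witness (λ z → free v z ∧ free y z) (<ᵇ-true⁻ Yy)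
        vb , xb = ∧-true⁻ vb∧xb
        vc , yc = ∧-true⁻ vc∧yc
    in no-free-closed-5-walk {v} {b} {x} {y} {c} vb (free-sym {x} {b} xb) xy yc (free-sym {v} {c} vc)

  X-free-disjoint : ∀ {x} → X x ≡ true → ∀ z → free v z ≡ true → free x z ≡ true → ⊥
  X-free-disjoint {x} Xx z vz xz = <⇒≱ (begin-strict
    0                             <⟨ ≤-reflexive (cong ⟦_⟧ (≡-sym (∧-true⁺ vz xz))) ⟩
    ⟦ free v z ∧ free x z ⟧       ≤⟨ f≤sum (λ z → ⟦ free v z ∧ free x z ⟧) z ⟩
    # (λ z → free v z ∧ free x z) ∎) (<ᵇ-false⁻ (not-true⁻ Xx))
    where open ≤-Reasoning

  -- The free neighbourhoods of v, x and y would be disjoint sets of more than n/3 vertices each.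
  X-free-independent : ∀ {x y} → good x ≡ true → good y ≡ true → X x ≡ true → X y ≡ true → free x y ≡ true → ⊥
  X-free-independent {x} {y} gx gy Xx Xy xy = <⇒≱ {n + n} {n} n+n<n (m≤m+n n n)
    where
    open ≤-Reasoning
    disjoint : # (free v) + (# (free x) + # (free y)) ≤ n
    disjoint = begin
      # (free v) + (# (free x) + # (free y))
        ≡⟨ cong (# (free v) +_) (∑-distrib-+ (⟦_⟧ ∘ free x) (⟦_⟧ ∘ free y)) ⟨
      # (free v) + sum (λ z → ⟦ free x z ⟧ + ⟦ free y z ⟧)
        ≡⟨ ∑-distrib-+ (⟦_⟧ ∘ free v) (λ z → ⟦ free x z ⟧ + ⟦ free y z ⟧) ⟨
      sum (λ z → ⟦ free v z ⟧ + (⟦ free x z ⟧ + ⟦ free y z ⟧))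
        ≤⟨ sum-mono-≤ (λ z → at-most-one (free v z) (free x z) (free y z)
             (X-free-disjoint Xx z)
             (λ xz yz → free-disjoint xy z (free⇒adj {x} {z} xz) (free⇒adj {y} {z} yz))
             (λ yz vz → X-free-disjoint Xy z vz yz)) ⟩
      sum {n} (λ _ → 1)  ≡⟨ sum-const n 1 ⟩
      n * 1              ≡⟨ *-identityʳ n ⟩
      n                  ∎
    k≤free+h : ∀ z → k ≤ # (free z) + h z
    k≤free+h z = ≤-reflexive (≡-sym (#free+h≡k z))
    50h≤n : ∀ z → good z ≡ true → 50 * h z < n
    50h≤n z gz = <ᵇ-true⁻ gz
    n+n<n : n + n < n
    -- The bounds combine to 60n ≤ 150k ≤ 53n - 3. Of the resulting 7n + 3 ≤ 0, the goal uses n + 1,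
    -- and 6n + 2 is slack.
    n+n<n = ≤-certificate (2 + 6 * n)
      (+-mono-≤ (*-monoʳ-≤ 50 disjoint)
        (+-mono-≤ (+-mono-≤ (50h≤n v (proj₂ good-vertex)) (+-mono-≤ (50h≤n x gx) (50h≤n y gy)))
          (+-mono-≤ (*-monoʳ-≤ 50 (+-mono-≤ (k≤free+h v) (+-mono-≤ (k≤free+h x) (k≤free+h y)))) (*-monoʳ-≤ 30 (<⇒≤ 2n<5k)))))
      (identity n k (# (free v)) (# (free x)) (# (free y)) (h v) (h x) (h y))
      where
      identity : ∀ n k a b c p q r →
        suc (n + n) + (50 * n + (n + (n + n) + (50 * (a + p + (b + q + (c + r))) + 30 * (5 * k)))) + (2 + 6 * n)
          ≡ n + (50 * (a + (b + c)) + (suc (50 * p) + (suc (50 * q) + suc (50 * r)) + (50 * (k + (k + k)) + 30 * (2 * n))))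
      identity = solve-∀

  -- Good vertices keep their class; a bad one joins the class with fewer of its good neighbours,
  -- where `<ᵇ suc` encodes ≤. Only good neighbours are compared, so moving bad vertices does not
  -- change the counts.
  side : Fin n → Bool
  side z = if good z then Y z else (goodNbrs Y z <ᵇ suc (goodNbrs X z))

  good∧side : ∀ y → good y ∧ side y ≡ good y ∧ Y y
  good∧side y = ∧-if-then (λ s → s) (good y) {Y y} {goodNbrs Y y <ᵇ suc (goodNbrs X y)}

  good∧not-side : ∀ y → good y ∧ not (side y) ≡ good y ∧ X y
  good∧not-side y = ∧-if-then not (good y) {Y y} {goodNbrs Y y <ᵇ suc (goodNbrs X y)}

  goodNbrs-side : ∀ z → goodNbrs side z ≡ goodNbrs Y z
  goodNbrs-side z = sum-cong-≗ λ y → cong (λ s → ⟦ adj G z y ∧ s ⟧) (good∧side y)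

  goodNbrs-not-side : ∀ z → goodNbrs (not ∘ side) z ≡ goodNbrs X z
  goodNbrs-not-side z = sum-cong-≗ λ y → cong (λ s → ⟦ adj G z y ∧ s ⟧) (good∧not-side y)

  good⇒Y : ∀ {x} → good x ≡ true → side x ≡ true → Y x ≡ true
  good⇒Y {x} gx sx = proj₂ (∧-true⁻ {good x} (trans (≡-sym (good∧side x)) (∧-true⁺ gx sx)))

  good⇒X : ∀ {x} → good x ≡ true → not (side x) ≡ true → X x ≡ true
  good⇒X {x} gx sx = proj₂ (∧-true⁻ {good x} (trans (≡-sym (good∧not-side x)) (∧-true⁺ gx sx)))

  side-bad : ∀ z → good z ≡ false → side z ≡ (goodNbrs Y z <ᵇ suc (goodNbrs X z))
  side-bad z bz = cong (if_then Y z else (goodNbrs Y z <ᵇ suc (goodNbrs X z))) bz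

  side-majority : ∀ z → good z ≡ false → side z ≡ true → goodNbrs side z ≤ goodNbrs (not ∘ side) z
  side-majority z bz sz = begin
    goodNbrs side z          ≡⟨ goodNbrs-side z ⟩
    goodNbrs Y z             ≤⟨ ≤-pred (<ᵇ-true⁻ (trans (≡-sym (side-bad z bz)) sz)) ⟩
    goodNbrs X z             ≡⟨ goodNbrs-not-side z ⟨
    goodNbrs (not ∘ side) z  ∎
    where open ≤-Reasoning

  not-side-majority : ∀ z → good z ≡ false → not (side z) ≡ true → goodNbrs (not ∘ side) z ≤ goodNbrs side z
  not-side-majority z bz sz = begin
    goodNbrs (not ∘ side) z  ≡⟨ goodNbrs-not-side z ⟩
    goodNbrs X z             ≤⟨ <⇒≤ (<ᵇ-false⁻ (trans (≡-sym (side-bad z bz)) (not-true⁻ sz))) ⟩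
    goodNbrs Y z             ≡⟨ goodNbrs-side z ⟨
    goodNbrs side z          ∎
    where open ≤-Reasoning

  -- Neither side can be the larger one, by `LargerSide.absurd`, so the sides have equal size.
  n-even : ∃ λ m → n ≡ m + m
  n-even = from (<-cmp (# side) (# (not ∘ side)))
    where
    from : Tri (# side < # (not ∘ side)) (# side ≡ # (not ∘ side)) (# (not ∘ side) < # side) → ∃ λ m → n ≡ m + m
    from (tri< s<t _ _) = ⊥-elim (LargerSide.absurd (not ∘ side) side
      (λ z → trans (+-comm ⟦ not (side z) ⟧ _) (⟦b⟧+⟦not-b⟧ (side z)))
      (λ {x} {y} gx gy sx sy → X-free-independent {x} {y} gx gy (good⇒X {x} gx sx) (good⇒X {y} gy sy))
      not-side-majority s<t)
    from (tri> _ _ t<s) = ⊥-elim (LargerSide.absurd side (not ∘ side) (λ z → ⟦b⟧+⟦not-b⟧ (side z))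
      (λ {x} {y} gx gy sx sy → Y-free-independent {x} {y} (good⇒Y {x} gx sx) (good⇒Y {y} gy sy))
      side-majority t<s)
    from (tri≈ _ s≡t _) = # side ,
      trans (≡-sym (#-complement λ z → ⟦b⟧+⟦not-b⟧ (side z))) (cong (# side +_) (≡-sym s≡t))

-- Sums over intervals and over full periods

sum-++ : ∀ m p (f : ℕ → ℕ) → sum {m + p} (f ∘ toℕ) ≡ sum {m} (f ∘ toℕ) + sum {p} (λ i → f (m + toℕ i))
sum-++ zero    p f = refl
sum-++ (suc m) p f = trans (cong (f 0 +_) (sum-++ m p (f ∘ suc))) (≡-sym (+-assoc (f 0) _ _))

sum-shift : ∀ m (f : ℕ → ℕ) → f 0 + sum {m} (f ∘ suc ∘ toℕ) ≡ sum {m} (f ∘ toℕ) + f m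
sum-shift zero    f = +-comm (f 0) 0
sum-shift (suc m) f = trans (cong (f 0 +_) (sum-shift m (f ∘ suc))) (≡-sym (+-assoc (f 0) _ _))

-- Moving the window by one step drops `f i` and gains `f (i + m)`, which is equal.
sum-periodic : ∀ m (f : ℕ → ℕ) → (∀ x → f (x + m) ≡ f x) → ∀ i → sum {m} (λ l → f (i + toℕ l)) ≡ sum {m} (f ∘ toℕ)
sum-periodic m f periodic zero    = refl
sum-periodic m f periodic (suc i) = +-cancelˡ-≡ (f i) _ _ (begin
  f i + sum {m} (λ l → f (suc i + toℕ l))
    ≡⟨ cong₂ _+_ (cong f (≡-sym (+-identityʳ i))) (sum-cong-≗ {m} λ l → cong f (≡-sym (+-suc i (toℕ l)))) ⟩
  f (i + 0) + sum {m} (λ l → f (i + suc (toℕ l)))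
    ≡⟨ sum-shift m (λ l → f (i + l)) ⟩
  sum {m} (λ l → f (i + toℕ l)) + f (i + m)
    ≡⟨ cong₂ _+_ (sum-periodic m f periodic i) (periodic i) ⟩
  sum {m} (f ∘ toℕ) + f i
    ≡⟨ +-comm _ (f i) ⟩
  f i + sum {m} (f ∘ toℕ) ∎)
  where open ≡-Reasoning

#-empty : ∀ n → # {n} (λ _ → false) ≡ 0
#-empty n = trans (sum-const n 0) (*-zeroʳ n)

#-<ᵇ : ∀ m t → t ≤ m → # {m} (λ l → toℕ l <ᵇ t) ≡ t
#-<ᵇ m       zero    _         = #-empty m
#-<ᵇ (suc m) (suc t) (s≤s t≤m) = cong suc (#-<ᵇ m t t≤m)

#-≡ᵇ : ∀ m t → t < m → # {m} (λ l → toℕ l ≡ᵇ t) ≡ 1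
#-≡ᵇ (suc m) zero    _         = cong suc (#-empty m)
#-≡ᵇ (suc m) (suc t) (s≤s t<m) = #-≡ᵇ m t t<m

#-antidiagonal : ∀ m i j → j ≤ m → # {m} (λ l → suc (i + toℕ l) ≡ᵇ j) ≡ ⟦ i <ᵇ j ⟧
#-antidiagonal m i       zero    _   = #-empty m
#-antidiagonal m zero    (suc j) j<m = #-≡ᵇ m j j<m
#-antidiagonal m (suc i) (suc j) j<m = #-antidiagonal m i j (<⇒≤ j<m)

<ᵇ-true⁺ : ∀ {m n} → m < n → (m <ᵇ n) ≡ true
<ᵇ-true⁺ = Equivalence.to T-≡ ∘ <⇒<ᵇ

<ᵇ-false⁺ : ∀ {m n} → n ≤ m → (m <ᵇ n) ≡ false
<ᵇ-false⁺ {m} {n} n≤m with m <ᵇ n in eq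
... | true  = ⊥-elim (<⇒≱ (<ᵇ-true⁻ {m} eq) n≤m)
... | false = refl

#≤n : ∀ {n} (P : Fin n → Bool) → # P ≤ n
#≤n {n} P = ≤-trans (#-mono {n} {P} {λ _ → true} λ _ _ → refl) (≤-reflexive (trans (sum-const n 1) (*-identityʳ n)))

-- A regular graph with few triangles

data Role : Set where
  apex       : Role
  left right : ℕ → Role

-- A bipartite circulant graph of degree 2j in which the matching {left i, right (j−1−i)}, i < j, is
-- replaced by the paths through the apex.
module Apex (m j : ℕ) .{{_ : NonZero m}} (2j≤m : j + j ≤ m) where

  -- Adjacency of `left i` and `right l` as a function of s = i + l. The excluded sum j - 1 is not
  -- reduced modulo `m`, so only `j` matching edges disappear and not a perfect matching.
  linked : ℕ → Bool
  linked s = (s % m <ᵇ j + j) ∧ not (suc s ≡ᵇ j)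

  link : Role → Role → Bool
  link apex      apex      = false
  link apex      (left i)  = i <ᵇ j
  link apex      (right i) = i <ᵇ j
  link (left i)  apex      = i <ᵇ j
  link (left i)  (left _)  = false
  link (left i)  (right l) = linked (i + l)
  link (right i) apex      = i <ᵇ j
  link (right i) (left l)  = linked (i + l)
  link (right i) (right _) = false

  link-sym : ∀ r s → link r s ≡ link s r
  link-sym apex      apex      = refl
  link-sym apex      (left i)  = refl
  link-sym apex      (right i) = refl
  link-sym (left i)  apex      = refl
  link-sym (left i)  (left l)  = refl
  link-sym (left i)  (right l) = cong linked (+-comm i l)
  link-sym (right i) apex      = refl
  link-sym (right i) (left l)  = cong linked (+-comm i l)
  link-sym (right i) (right l) = refl

  link-irrefl : ∀ r → link r r ≡ false
  link-irrefl apex      = refl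
  link-irrefl (left i)  = refl
  link-irrefl (right i) = refl

  -- The apex has index zero, so it comes first in every increasing triple that contains it.
  base role : ℕ → Role
  base i       = if i <ᵇ m then left i else right (i ∸ m)
  role zero    = apex
  role (suc i) = base i

  G : Graph (suc (m + m))
  G = record
    { adj    = λ x y → link (role (toℕ x)) (role (toℕ y))
    ; sym    = λ x y → link-sym (role (toℕ x)) (role (toℕ y))
    ; irrefl = λ x → link-irrefl (role (toℕ x))
    }

  j≤m : j ≤ m
  j≤m = ≤-trans (m≤m+n j j) 2j≤m

  #-linked : ∀ i → ⟦ i <ᵇ j ⟧ + # {m} (λ l → linked (i + toℕ l)) ≡ j + j
  #-linked i = begin
    ⟦ i <ᵇ j ⟧ + # {m} (λ l → linked (i + toℕ l))
      -- The edge to the apex stands for the matching edge at `i`: its other end j - 1 - i exists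
      -- exactly when i < j, and `j≤m` keeps it in range. Once it is restored, the sums i + l run
      -- through a full period, in which 2j residues are below 2j.
      ≡⟨ trans (+-comm ⟦ i <ᵇ j ⟧ _) (cong (# {m} (λ l → linked (i + toℕ l)) +_) (≡-sym (#-antidiagonal m i j j≤m))) ⟩
    # {m} (λ l → linked (i + toℕ l)) + # {m} (λ l → suc (i + toℕ l) ≡ᵇ j)
      ≡⟨ ∑-distrib-+ {m} (λ l → ⟦ linked (i + toℕ l) ⟧) (λ l → ⟦ suc (i + toℕ l) ≡ᵇ j ⟧) ⟨
    sum {m} (λ l → ⟦ linked (i + toℕ l) ⟧ + ⟦ suc (i + toℕ l) ≡ᵇ j ⟧)
      ≡⟨ sum-cong-≗ {m} (λ l → removed (matched (i + toℕ l))) ⟩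
    sum {m} (λ l → residue (i + toℕ l))
      ≡⟨ sum-periodic m residue (λ x → cong (λ r → ⟦ r <ᵇ j + j ⟧) ([m+n]%n≡m%n x m)) i ⟩
    sum {m} (residue ∘ toℕ)
      ≡⟨ sum-cong-≗ {m} (λ l → cong (λ r → ⟦ r <ᵇ j + j ⟧) (m<n⇒m%n≡m (toℕ<n l))) ⟩
    # {m} (λ l → toℕ l <ᵇ j + j)
      ≡⟨ #-<ᵇ m (j + j) 2j≤m ⟩
    j + j ∎
    where
    open ≡-Reasoning
    residue : ℕ → ℕ
    residue s = ⟦ s % m <ᵇ j + j ⟧
    -- A removed edge was present in the circulant: s < j ≤ m, so `s` is its own residue and is
    -- below 2j.
    matched : ∀ s → (suc s ≡ᵇ j) ≡ true → (s % m <ᵇ j + j) ≡ true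
    matched s eq = <ᵇ-true⁺ (subst (_< j + j) (≡-sym (m<n⇒m%n≡m (≤-trans s<j j≤m))) (≤-trans s<j (m≤m+n j j)))
      where
      s<j : s < j
      s<j = ≤-reflexive (≡ᵇ⇒≡ (suc s) j (Equivalence.from T-≡ eq))
    removed : ∀ {p q} → (q ≡ true → p ≡ true) → ⟦ p ∧ not q ⟧ + ⟦ q ⟧ ≡ ⟦ p ⟧
    removed {true}  {true}  _   = refl
    removed {true}  {false} _   = refl
    removed {false} {false} _   = refl
    removed {false} {true}  q⇒p with () ← q⇒p refl

  #-link : ∀ r → # {suc (m + m)} (λ y → link r (role (toℕ y)))
                 ≡ ⟦ link r apex ⟧ + (# {m} (λ l → link r (left (toℕ l))) + # {m} (λ l → link r (right (toℕ l))))
  #-link r = cong (⟦ link r apex ⟧ +_) (trans (sum-++ m m (λ i → ⟦ link r (base i) ⟧))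
    (cong₂ _+_ (sum-cong-≗ {m} λ l → cong (⟦_⟧ ∘ link r) (base-left l)) (sum-cong-≗ {m} λ l → cong (⟦_⟧ ∘ link r) (base-right (toℕ l)))))
    where
    base-left : ∀ (l : Fin m) → base (toℕ l) ≡ left (toℕ l)
    base-left l = cong (if_then left (toℕ l) else right (toℕ l ∸ m)) (<ᵇ-true⁺ (toℕ<n l))
    base-right : ∀ l → base (m + l) ≡ right l
    base-right l = trans (cong (if_then left (m + l) else right (m + l ∸ m)) (<ᵇ-false⁺ (m≤m+n m l)))
      (cong right (m+n∸m≡n m l))

  link-regular : ∀ r → # {suc (m + m)} (λ y → link r (role (toℕ y))) ≡ j + j
  link-regular apex      = trans (#-link apex) (cong₂ _+_ (#-<ᵇ m j j≤m) (#-<ᵇ m j j≤m))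
  link-regular (left i)  = trans (#-link (left i))
    (trans (cong (λ e → ⟦ i <ᵇ j ⟧ + (e + # {m} (λ l → linked (i + toℕ l)))) (#-empty m)) (#-linked i))
  link-regular (right i) = trans (#-link (right i))
    (trans (cong (⟦ i <ᵇ j ⟧ +_) (trans (cong (# {m} (λ l → linked (i + toℕ l)) +_) (#-empty m)) (+-identityʳ _))) (#-linked i))

  regular : Regular (j + j) G
  regular x = trans (degree≡# G x) (link-regular (role (toℕ x)))

  -- Two of three vertices lie in the same part and are not adjacent.
  base-triangle-free : ∀ x y z → link (base x) (base y) ∧ link (base y) (base z) ∧ link (base x) (base z) ≡ false
  base-triangle-free x y z with x <ᵇ m | y <ᵇ m | z <ᵇ m
  ... | true  | true  | _     = refl
  ... | true  | false | true  = trans (cong (linked (x + (y ∸ m)) ∧_) (∧-zeroʳ _)) (∧-zeroʳ _)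
  ... | true  | false | false = ∧-zeroʳ _
  ... | false | true  | true  = ∧-zeroʳ _
  ... | false | true  | false = trans (cong (linked (x ∸ m + y) ∧_) (∧-zeroʳ _)) (∧-zeroʳ _)
  ... | false | false | _     = refl

  -- An increasing triple that starts after the apex avoids it, so its vertices all lie in the
  -- bipartite part.
  triangle∋apex : ∀ x y z → isTriangle G (suc x , y , z) ≡ false
  triangle∋apex x zero    z       = refl
  triangle∋apex x (suc y) zero    with toℕ (suc x) <? toℕ (suc y)
  ... | yes _ = refl
  ... | no  _ = refl
  triangle∋apex x (suc y) (suc z) with toℕ (suc x) <? toℕ (suc y) | toℕ (suc y) <? toℕ (suc z)
  ... | yes _ | yes _ = base-triangle-free (toℕ x) (toℕ y) (toℕ z)
  ... | yes _ | no  _ = refl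
  ... | no  _ | _     = refl

  -- Only the triples that start at the apex contribute, and they leave n² choices for the other two
  -- entries.
  triangles≤n² : triangles G ≤ suc (m + m) * suc (m + m)
  triangles≤n² = begin
    triangles G                                 ≡⟨ triangles≡sum G ⟩
    at zero + sum {m + m} (at ∘ suc)            ≤⟨ +-mono-≤ at-zero (≤-reflexive at-suc) ⟩
    n * n + 0                                   ≡⟨ +-identityʳ (n * n) ⟩
    n * n                                       ∎
    where
    open ≤-Reasoning
    n = suc (m + m)
    at : Fin n → ℕ
    at x = sum {n} (λ y → # {n} (λ z → isTriangle G (x , y , z)))
    at-zero : at zero ≤ n * n
    at-zero = ≤-trans (sum-mono-≤ {n} λ y → #≤n {n} (λ z → isTriangle G (zero , y , z))) (≤-reflexive (sum-const n n))
    at-suc : sum {m + m} (at ∘ suc) ≡ 0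
    at-suc = trans (sum-cong-≗ {m + m} λ x → trans
        (sum-cong-≗ {n} λ y → trans (sum-cong-≗ {n} λ z → cong ⟦_⟧ (triangle∋apex x y z)) (#-empty n))
        (#-empty n)) (#-empty (m + m))

-- Rational constants, floors and the two bounds

1/suc*≤ : ∀ d a b → a ≤ suc d * b → (ℤ.+ 1 /ℚ suc d) *ℚ ℕ→ℚ a ≤ℚ ℕ→ℚ b
1/suc*≤ d a b a≤ = ℚ.toℚᵘ-cancel-≤ (begin
  toℚᵘ ((ℤ.+ 1 /ℚ suc d) *ℚ ℕ→ℚ a)              ≃⟨ ℚ.toℚᵘ-homo-* (ℤ.+ 1 /ℚ suc d) (ℕ→ℚ a) ⟩
  toℚᵘ (ℤ.+ 1 /ℚ suc d) ℚᵘ.* toℚᵘ (ℕ→ℚ a)     ≃⟨ ℚᵘ.*-cong (ℚ.toℚᵘ-fromℚᵘ (ℚᵘ.mkℚᵘ (ℤ.+ 1) d)) (ℚ.toℚᵘ-fromℚᵘ (ℚᵘ.mkℚᵘ (ℤ.+ a) 0)) ⟩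
  -- Among unnormalised fractions the comparison is cross multiplication of integers.
  ℚᵘ.mkℚᵘ (ℤ.+ 1) d ℚᵘ.* ℚᵘ.mkℚᵘ (ℤ.+ a) 0        ≤⟨ ℚᵘ.*≤* integers ⟩
  ℚᵘ.mkℚᵘ (ℤ.+ b) 0                               ≃⟨ ℚ.toℚᵘ-fromℚᵘ (ℚᵘ.mkℚᵘ (ℤ.+ b) 0) ⟨
  toℚᵘ (ℕ→ℚ b)                                  ∎)
  where
  open ℚᵘ.≤-Reasoning
  integers : ℤ.+ 1 ℤ.* ℤ.+ a ℤ.* ℤ.+ 1 ℤ.≤ ℤ.+ b ℤ.* ℤ.+ (suc d * 1)
  integers rewrite ℤ.*-identityʳ (ℤ.+ 1 ℤ.* ℤ.+ a) | ℤ.*-identityˡ (ℤ.+ a) | *-identityʳ (suc d)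
    | ≡-sym (ℤ.pos-* b (suc d)) | *-comm b (suc d) = ℤ.+≤+ a≤

0<1/suc : ∀ d → 0ℚ <ℚ ℤ.+ 1 /ℚ suc d
0<1/suc d = ℚ.positive⁻¹ (ℤ.+ 1 /ℚ suc d) {{ℚ.normalize-pos 1 (suc d)}}

n^2≡n*n : ∀ n → n ^ 2 ≡ n * n
n^2≡n*n n = cong (n *_) (*-identityʳ n)

-- The constant is 2500 · 6, the factor six coming from the orderings of a triangle. With fewer
-- triangles `n` would be even.
n²≤15000triangles : ∀ {n k} (G : Graph n) → (∃ λ m → n ≡ 2 * m + 1) → 2 * n < 5 * k → Regular k G →
  n ^ 2 ≤ 15000 * triangles G
n²≤15000triangles {n} {k} G (m , n≡2m+1) 2n<5k reg = begin
  n ^ 2                      ≡⟨ n^2≡n*n n ⟩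
  n * n                      ≤⟨ ≮⇒≥ many ⟩
  2500 * orderedTriangles G  ≤⟨ *-monoʳ-≤ 2500 (orderedTriangles≤6*triangles G) ⟩
  2500 * (6 * triangles G)   ≡⟨ *-assoc 2500 6 (triangles G) ⟨
  15000 * triangles G        ∎
  where
  open ≤-Reasoning
  many : ¬ 2500 * orderedTriangles G < n * n
  many few = let p , n≡p+p = FewTriangles.n-even G (λ x → trans (≡-sym (degree≡# G x)) (reg x)) 2n<5k few in
    even≢odd p m (trans (cong (p +_) (+-identityʳ p)) (trans (≡-sym n≡p+p) (trans n≡2m+1 (+-comm (2 * m) 1))))

regular-graph-with-few-triangles : ∀ {n k} m j → n ≡ suc (m + m) → k ≡ j + j → 0 < j → j + j ≤ m →
  Σ (Graph n) λ G → Regular k G × triangles G ≤ n ^ 2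
-- Residues modulo `m` require m > 0; for m = 0 no positive `j` satisfies 2j ≤ m.
regular-graph-with-few-triangles zero    (suc j) _    _    _ ()
regular-graph-with-few-triangles (suc m) j       refl refl _ 2j≤m =
  G , regular , ≤-trans triangles≤n² (≤-reflexive (≡-sym (n^2≡n*n (suc (suc m + suc m)))))
  where open Apex (suc m) j 2j≤m

n/5<j⇒2n<5k : ∀ n j → n / 5 < j → 2 * n < 5 * (2 * j)
n/5<j⇒2n<5k n j n/5<j = begin-strict
  2 * n                   ≡⟨ cong (2 *_) (m≡m%n+[m/n]*n n 5) ⟩
  2 * (n % 5 + n / 5 * 5) <⟨ *-monoʳ-< 2 (+-monoˡ-< (n / 5 * 5) (m%n<n n 5)) ⟩
  2 * (suc (n / 5) * 5)   ≤⟨ *-monoʳ-≤ 2 (*-monoˡ-≤ 5 n/5<j) ⟩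
  2 * (j * 5)             ≡⟨ rearrange j ⟩
  5 * (2 * j)             ∎
  where
  open ≤-Reasoning
  rearrange : ∀ j → 2 * (j * 5) ≡ 5 * (2 * j)
  rearrange = solve-∀

-- Parity: 4j ≤ 2m + 1 already forces 4j ≤ 2m. If m < 2j, then n < 2m + 2 ≤ 4j ≤ n.
j≤n/4⇒2j≤m : ∀ {n} m j → n ≡ suc (m + m) → j ≤ n / 4 → j + j ≤ m
j≤n/4⇒2j≤m {n} m j n≡ j≤n/4 = ≮⇒≥ λ m<2j → <⇒≱ (begin-strict
  n                  ≡⟨ n≡ ⟩
  suc (m + m)        <⟨ s≤s (≤-reflexive (≡-sym (+-suc m m))) ⟩
  suc m + suc m      ≤⟨ +-mono-≤ m<2j m<2j ⟩
  j + j + (j + j)    ≡⟨ four j ⟩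
  j * 4              ≤⟨ *-monoˡ-≤ 4 j≤n/4 ⟩
  n / 4 * 4          ∎) (m/n*n≤m n 4)
  where
  open ≤-Reasoning
  four : ∀ j → j + j + (j + j) ≡ j * 4
  four = solve-∀

theorem10 : Σ ℚ λ c → Σ ℚ λ C → (0ℚ <ℚ c) × (0ℚ <ℚ C) ×
    ((n k : ℕ) → (∃ λ m → n ≡ 2 * m + 1) → (∃ λ m → k ≡ 2 * m) →
    2 * (n / 5) < k → k ≤ 2 * (n / 4) →
    ((G : Graph n) → Regular k G → c *ℚ ℕ→ℚ (n ^ 2) ≤ℚ ℕ→ℚ (triangles G))
    × (Σ (Graph n) λ G → Regular k G × (ℕ→ℚ (triangles G) ≤ℚ C *ℚ ℕ→ℚ (n ^ 2))))
theorem10 = ℤ.+ 1 /ℚ 15000 , 1ℚ , 0<1/suc 14999 , 0<1/suc 0 , bounds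
  where
  bounds : (n k : ℕ) → (∃ λ m → n ≡ 2 * m + 1) → (∃ λ m → k ≡ 2 * m) → 2 * (n / 5) < k → k ≤ 2 * (n / 4) →
    ((G : Graph n) → Regular k G → (ℤ.+ 1 /ℚ 15000) *ℚ ℕ→ℚ (n ^ 2) ≤ℚ ℕ→ℚ (triangles G))
    × (Σ (Graph n) λ G → Regular k G × (ℕ→ℚ (triangles G) ≤ℚ 1ℚ *ℚ ℕ→ℚ (n ^ 2)))
  bounds n k n-odd@(m , n≡2m+1) (j , refl) lower upper =
    (λ G reg → 1/suc*≤ 14999 (n ^ 2) (triangles G) (n²≤15000triangles G n-odd (n/5<j⇒2n<5k n j n/5<j) reg)) ,
    (let G , reg , few = regular-graph-with-few-triangles m j n≡1+m+m (cong (j +_) (+-identityʳ j))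
                           (≤-<-trans z≤n n/5<j) (j≤n/4⇒2j≤m m j n≡1+m+m (*-cancelˡ-≤ 2 upper))
     in G , reg , ℚ.≤-trans (ℚ.≤-reflexive (≡-sym (ℚ.*-identityˡ (ℕ→ℚ (triangles G)))))
          (ℚ.≤-trans (1/suc*≤ 0 (triangles G) (n ^ 2) (≤-trans few (≤-reflexive (≡-sym (*-identityˡ (n ^ 2))))))
            (ℚ.≤-reflexive (≡-sym (ℚ.*-identityˡ (ℕ→ℚ (n ^ 2)))))))
    where
    n/5<j : n / 5 < j
    n/5<j = *-cancelˡ-< 2 (n / 5) j lower
    n≡1+m+m : n ≡ suc (m + m)
    n≡1+m+m = trans n≡2m+1 (trans (+-comm (2 * m) 1) (cong (λ p → suc (m + p)) (+-identityʳ m)))
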